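{- Extension Dominating Set can be solved in polynomial time on split graphs.
   Context: For a graph $G=(V,E)$, $D\subseteq V$ is a dominating set if every vertex is in $D$ or has a neighbor in $D$; it is minimal if no proper subset is a dominating set. Extension Dominating Set: given a graph $G=(V,E)$ and $U\subseteq V$, decide whether there is a minimal dominating set $D$ with $U\subseteq D$. A split graph is a graph whose vertex set partitions into a clique and an independent set. -}

module Defs where

open import Data.Nat using (ℕ; zero; suc)
open import Data.Bool using (Bool; true; false)
open import Data.Fin using (Fin; _≟_)
open import Data.Fin.Subset using (Subset; _∈_; _∉_; _⊆_; _⊂_)
open import Data.List using (List; []; _∷_; _++_; concatMap; allFin; map)
open import Data.Vec using (toList)
open import Data.Maybe using (Maybe; just; nothing)
open import Data.Product using (Σ; ∃; ∃-syntax; _×_; _,_)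
open import Data.Sum using (_⊎_)
open import Relation.Nullary using (¬_; yes; no)
open import Relation.Binary.PropositionalEquality using (_≡_; _≢_)

Adjacency : ℕ → Set
Adjacency n = Fin n → Fin n → Bool

IsSimple : ∀ {n} → Adjacency n → Set
IsSimple {n} A = (∀ u v → A u v ≡ A v u) × (∀ v → A v v ≡ false)

IsDominating : ∀ {n} → Adjacency n → Subset n → Set
IsDominating {n} A D = ∀ v → v ∈ D ⊎ (∃[ u ] (u ∈ D × A u v ≡ true))

IsMinimalDominating : ∀ {n} → Adjacency n → Subset n → Set
IsMinimalDominating {n} A D =
  IsDominating A D × (∀ (D' : Subset n) → D' ⊂ D → ¬ IsDominating A D')

ExtensionDS : ∀ {n} → Adjacency n → Subset n → Set
ExtensionDS {n} A U = ∃[ D ] (IsMinimalDominating A D × U ⊆ D)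

IsSplit : ∀ {n} → Adjacency n → Set
IsSplit {n} A = ∃[ K ]
  ( (∀ u v → u ∈ K → v ∈ K → u ≢ v → A u v ≡ true)
  × (∀ u v → u ∉ K → v ∉ K → A u v ≡ false))

-- Model of computation: deterministic single-tape Turing machines over
-- the tape alphabet Fin 4 = {blank, 0, 1, #} (symbol 0 is the blank).

Sym : Set
Sym = Fin 4

blank : Sym
blank = Fin.zero
  where import Data.Fin as Fin

data Dir : Set where
  left right : Dir

record TM : Set where
  field
    Q      : ℕ
    start  : Fin Q
    accept : Fin Q
    reject : Fin Q
    δ      : Fin Q → Sym → Fin Q × Sym × Dir

record Config (M : TM) : Set where
  constructor cfg
  field
    state : Fin (TM.Q M)
    lefts : List Sym   -- cells left of the head, nearest first
    head  : Sym
    rights : List Sym  -- cells right of the head, nearest first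

module _ (M : TM) where
  open TM M

  halted? : Fin Q → Bool
  halted? q with q ≟ accept
  ... | yes _ = true
  ... | no _ with q ≟ reject
  ...   | yes _ = true
  ...   | no _ = false

  move : Fin Q → Sym → Dir → List Sym → List Sym → Config M
  move q s left []        rs = cfg q [] blank (s ∷ rs)
  move q s left (l ∷ ls)  rs = cfg q ls l (s ∷ rs)
  move q s right ls []       = cfg q (s ∷ ls) blank []
  move q s right ls (r ∷ rs) = cfg q (s ∷ ls) r rs

  step : Config M → Config M
  step (cfg q ls h rs) with halted? q
  ... | true = cfg q ls h rs
  ... | false with δ q h
  ...   | q' , s , d = move q' s d ls rs

  run : ℕ → Config M → Config M
  run zero    c = c
  run (suc t) c = run t (step c)

  initial : List Sym → Config M
  initial []       = cfg start [] blank []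
  initial (x ∷ xs) = cfg start [] x xs

  outcome : List Sym → ℕ → Maybe Bool
  outcome x t with Config.state (run t (initial x))
  ... | q with q ≟ accept
  ...   | yes _ = just true
  ...   | no _ with q ≟ reject
  ...     | yes _ = just false
  ...     | no _ = nothing

bitSym : Bool → Sym
bitSym false = Fin.suc Fin.zero
  where import Data.Fin as Fin
bitSym true  = Fin.suc (Fin.suc Fin.zero)
  where import Data.Fin as Fin

sepSym : Sym
sepSym = Fin.suc (Fin.suc (Fin.suc Fin.zero))
  where import Data.Fin as Fin

encode : ∀ n → Adjacency n → Subset n → List Sym
encode n A U =
  concatMap (λ u → map (λ v → bitSym (A u v)) (allFin n)) (allFin n)
  ++ sepSym ∷ map bitSym (toList U)

{-# OPTIONS --safe #-}
module Submission where

-- On a split graph, U extends to a minimal dominating set iff U is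
-- irredundant: every u ∈ U has a w with N[w] ∩ U = {u}.  Necessity holds in
-- every graph.  Conversely, let K be the clique.  If U meets K, then U together
-- with the vertices outside K that have no neighbour in U works.  If U misses
-- K, either the complement of K dominates and is the required set, or some
-- k ∈ K has no neighbour outside K and U ∪ {k} is still irredundant.
--
-- Irredundance is decided in one pass over the rows w of the matrix: if
-- exactly one u ∈ U lies in N[w], that u is marked as served; U is irredundant
-- iff everything in U is served in the end.  The machine does this by sweeps
-- over the tape.  With n columns, consuming one matrix bit per sweep costs
-- O(n²) sweeps of length O(n²), which is quadratic in the input length.

open import Defs
open import Data.Nat using (ℕ; zero; suc; pred; _+_; _*_; _^_; _≤_; _<_; z≤n; s≤s)
open import Data.Nat.Properties using (+-comm; +-suc; +-identityʳ; +-mono-≤; +-monoʳ-≤; +-monoˡ-≤; *-mono-≤; *-monoʳ-≤; ≤-refl; ≤-trans; ≤-reflexive; n≤1+n; m≤m+n; m≤n⇒m<n∨m≡n; module ≤-Reasoning)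
open import Data.Nat.Solver using (module +-*-Solver)
open import Data.Bool using (Bool; true; false)
import Data.Bool as Bool
open import Data.Empty using (⊥-elim)
open import Data.Fin using (Fin; zero; suc; toℕ; splitAt; join; combine; remQuot; _≟_)
open import Data.Fin.Patterns using (0F; 1F; 2F; 3F; 4F; 5F; 6F; 7F; 8F)
open import Data.Fin.Properties using (splitAt-join; remQuot-combine; any?; ¬∀⟶∃¬; toℕ-injective; toℕ<n; suc-injective)
open import Data.Fin.Subset using (Subset; _∈_; _∉_)
open import Data.Fin.Subset.Properties using (_∈?_)
open import Data.List using (List; []; _∷_; [_]; _++_; _ʳ++_; concat; concatMap; map; replicate; length; tabulate; allFin)
open import Data.List.Properties using (length-map; length-++; length-tabulate; map-++; map-∘; map-cong; map-tabulate; tabulate-cong; ++-assoc; ++-identityʳ; ++-ʳ++)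
open import Data.List.Relation.Unary.All using (All; []; _∷_)
open import Data.List.Relation.Unary.All.Properties using (++⁺; tabulate⁺)
open import Data.Maybe using (just)
open import Data.Product using (Σ; ∃-syntax; _×_; _,_; proj₁; proj₂; map₁; map₂)
open import Data.Sum as Sum using (_⊎_; inj₁; inj₂)
import Data.Vec as Vec
open import Data.Vec.Properties using (lookup∘tabulate; lookup⇒[]=; []=⇒lookup)
open import Function using (_∘_; id)
open import Relation.Nullary using (¬_; Dec; yes; no; does; ¬?; _×-dec_; _⊎-dec_; contradiction)
open import Relation.Unary using (Decidable)
open import Relation.Binary.PropositionalEquality using (_≡_; _≢_; refl; sym; trans; cong; cong₂; subst)

-- Irredundance and minimal dominating sets

module _ {n} {P : Fin n → Set} (P? : Decidable P) where

  ⟪_⟫ : Subset n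
  ⟪_⟫ = Vec.tabulate (does ∘ P?)

  ∈⟪⟫⁺ : ∀ {i} → P i → i ∈ ⟪_⟫
  ∈⟪⟫⁺ {i} p = lookup⇒[]= i _ (trans (lookup∘tabulate _ i) (holds (P? i)))
    where
    holds : (d : Dec (P i)) → does d ≡ true
    holds (yes _) = refl
    holds (no ¬p) = contradiction p ¬p

  ∈⟪⟫⁻ : ∀ {i} → i ∈ ⟪_⟫ → P i
  ∈⟪⟫⁻ {i} i∈ = witness (P? i) (trans (sym (lookup∘tabulate _ i)) ([]=⇒lookup i∈))
    where
    witness : (d : Dec (P i)) → does d ≡ true → P i
    witness (yes p) _ = p
    witness (no _) ()

-- Membership of `j` in the closed neighbourhood N[w]. A `w` whose closed neighbourhood meets a set
-- only in u is called private to u below.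
Near : ∀ {n} → Adjacency n → Fin n → Fin n → Set
Near A w j = w ≡ j ⊎ A w j ≡ true

Irredundant : ∀ {n} → Adjacency n → Subset n → Set
Irredundant A U = ∀ u → u ∈ U → ∃[ w ] (Near A w u × (∀ j → j ∈ U → Near A w j → j ≡ u))

module _ {n} (A : Adjacency n) (simple : IsSimple A) where

  flip : ∀ {u v} → A u v ≡ true → A v u ≡ true
  flip {u} {v} e = trans (proj₁ simple v u) e

  irreflexive : ∀ {v} → A v v ≢ true
  irreflexive {v} e with trans (sym (proj₂ simple v)) e
  ... | ()

  dominator : ∀ {D v} → v ∈ D ⊎ (∃[ u ] (u ∈ D × A u v ≡ true)) → ∃[ y ] (y ∈ D × Near A v y)
  dominator {v = v} (inj₁ v∈D)         = v , v∈D , inj₁ refl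
  dominator (inj₂ (u , u∈D , e))       = u , u∈D , inj₂ (flip e)

  dominated : ∀ {D v y} → y ∈ D → Near A v y → v ∈ D ⊎ (∃[ u ] (u ∈ D × A u v ≡ true))
  dominated y∈D (inj₁ refl) = inj₁ y∈D
  dominated y∈D (inj₂ e)    = inj₂ (_ , y∈D , flip e)

  -- A proper subset omits some `x` of `D`. Whatever dominates the vertex `w` belonging to `x` lies
  -- in `D` and near `w`, hence is `x` itself, so the subset leaves `w` undominated.
  minimal : ∀ {D} → IsDominating A D → (∀ x → x ∈ D → ∃[ w ] (∀ y → y ∈ D → Near A w y → y ≡ x)) →
            IsMinimalDominating A D
  minimal dom own = dom , λ D′ (D′⊆D , x , x∈D , x∉D′) dom′ →
    let (w , unique) = own x x∈D
        (y , y∈D′ , near) = dominator (dom′ w)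
    in x∉D′ (subst (_∈ D′) (unique y (D′⊆D y∈D′) near) y∈D′)

  other? : ∀ (D : Subset n) u → Decidable (λ v → v ∈ D × v ≢ u)
  other? D u v = (v ∈? D) ×-dec ¬? (v ≟ u)

  dominated? : ∀ D → Decidable (λ v → v ∈ D ⊎ (∃[ y ] (y ∈ D × A y v ≡ true)))
  dominated? D v = (v ∈? D) ⊎-dec any? (λ y → (y ∈? D) ×-dec (A y v Bool.≟ true))

  -- By minimality, `D` without `u` misses some vertex `w`. Every member of `D` near `w` must then
  -- be `u`, and since `D` dominates `w`, there is such a member.
  extensible⇒irredundant : ∀ {U} → ExtensionDS A U → Irredundant A U
  extensible⇒irredundant (D , (dom , min) , U⊆D) u u∈U
    with ¬∀⟶∃¬ n _ (dominated? ⟪ other? D u ⟫) (min ⟪ other? D u ⟫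
           ((λ i∈ → proj₁ (∈⟪⟫⁻ (other? D u) i∈)) , u , U⊆D u∈U , λ u∈ → proj₂ (∈⟪⟫⁻ (other? D u) u∈) refl))
  ... | w , undominated = w , near-u , λ j j∈U → only-u j (U⊆D j∈U)
    where
    only-u : ∀ j → j ∈ D → Near A w j → j ≡ u
    only-u j j∈D near with j ≟ u
    ... | yes eq = eq
    ... | no ne = ⊥-elim (undominated (dominated (∈⟪⟫⁺ (other? D u) (j∈D , ne)) near))
    near-u : Near A w u
    near-u = let (y , y∈D , near) = dominator (dom w) in subst (Near A w) (only-u y y∈D near) near

  -- Irredundant sets extend on split graphs

  module _ (K : Subset n)
           (clique      : ∀ u v → u ∈ K → v ∈ K → u ≢ v → A u v ≡ true)
           (independent : ∀ u v → u ∉ K → v ∉ K → A u v ≡ false) where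

    K-near : ∀ {u v} → u ∈ K → v ∈ K → Near A u v
    K-near {u} {v} u∈K v∈K with u ≟ v
    ... | yes eq = inj₁ eq
    ... | no ne  = inj₂ (clique u v u∈K v∈K ne)

    adjacent-outside : ∀ {u v} → v ∉ K → A v u ≡ true → u ∈ K
    adjacent-outside {u} {v} v∉K e with u ∈? K
    ... | yes u∈K = u∈K
    ... | no u∉K with trans (sym e) (independent v u v∉K u∉K)
    ...   | ()

    module Meeting {U} (irr : Irredundant A U) {k} (k∈U : k ∈ U) (k∈K : k ∈ K) where

      -- Take `w` private to `x`. If `w` is `x`, then `y` lies in N[x] and equals `x`, a loop.
      -- Otherwise `w` and `y` are both neighbours of a vertex outside the clique, so both lie in
      -- `K`; then `y` is near `w` and equals `x`, which is outside `K`.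
      isolated : ∀ {x y} → x ∈ U → x ∉ K → y ∈ U → A x y ≢ true
      isolated {x} {y} x∈U x∉K y∈U e with irr x x∈U
      ... | w , inj₁ refl , unique = irreflexive (subst (λ z → A x z ≡ true) (unique y y∈U (inj₂ e)) e)
      ... | w , inj₂ wx , unique = x∉K (subst (_∈ K) (unique y y∈U (K-near w∈K y∈K)) y∈K)
        where
        y∈K = adjacent-outside x∉K e
        w∈K = adjacent-outside x∉K (flip wx)

      Chosen : Fin n → Set
      Chosen v = v ∈ U ⊎ (v ∉ K × ¬ (∃[ y ] (y ∈ U × A v y ≡ true)))

      chosen? : Decidable Chosen
      chosen? v = (v ∈? U) ⊎-dec (¬? (v ∈? K) ×-dec ¬? (any? (λ y → (y ∈? U) ×-dec (A v y Bool.≟ true))))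

      D : Subset n
      D = ⟪ chosen? ⟫

      inK : ∀ {y} → y ∈ D → y ∈ K → y ∈ U
      inK y∈D y∈K with ∈⟪⟫⁻ chosen? y∈D
      ... | inj₁ y∈U       = y∈U
      ... | inj₂ (y∉K , _) = contradiction y∈K y∉K

      outK : ∀ {x y} → x ∈ D → x ∉ K → y ∈ U → A x y ≢ true
      outK x∈D x∉K y∈U e with ∈⟪⟫⁻ chosen? x∈D
      ... | inj₁ x∈U      = isolated x∈U x∉K y∈U e
      ... | inj₂ (_ , ne) = ne (_ , y∈U , e)

      dominating : IsDominating A D
      dominating v with v ∈? K
      ... | yes v∈K = dominated (∈⟪⟫⁺ chosen? (inj₁ k∈U)) (K-near v∈K k∈K)
      ... | no v∉K with any? (λ y → (y ∈? U) ×-dec (A v y Bool.≟ true))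
      ...   | yes (y , y∈U , e) = dominated (∈⟪⟫⁺ chosen? (inj₁ y∈U)) (inj₂ e)
      ...   | no ne = inj₁ (∈⟪⟫⁺ chosen? (inj₂ (v∉K , ne)))

      -- The added vertices lie outside `K` and have no neighbour in `U`, while `D` inside `K` is
      -- part of `U`. Hence a vertex of `D` outside `K` is private to itself, and one inside `K` can
      -- fall back on its irredundance witness.
      private-neighbour : ∀ x → x ∈ D → ∃[ w ] (∀ y → y ∈ D → Near A w y → y ≡ x)
      private-neighbour x x∈D with x ∈? K
      ... | no x∉K = x , λ where
        y y∈D (inj₁ eq) → sym eq
        y y∈D (inj₂ e)  → ⊥-elim (outK x∈D x∉K (inK y∈D (adjacent-outside x∉K e)) e)
      ... | yes x∈K with irr x (inK x∈D x∈K)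
      ...   | w , wx , unique with w ∈? K
      -- A witness in `K` is near all of `K`, so `x` is the only vertex of `D` in the clique. By
      -- `outK` no vertex of `D` outside `K` is adjacent to `x`, so `x` is private to itself.
      ...     | yes w∈K = x , λ y y∈D near → only y y∈D near (y ∈? K)
        where
        only : ∀ y → y ∈ D → Near A x y → Dec (y ∈ K) → y ≡ x
        only y y∈D _         (yes y∈K) = unique y (inK y∈D y∈K) (K-near w∈K y∈K)
        only y y∈D (inj₁ eq) (no y∉K)  = sym eq
        only y y∈D (inj₂ e)  (no y∉K)  = ⊥-elim (outK y∈D y∉K (inK x∈D x∈K) (flip e))
      -- Neighbours of `w` lie in `K`, where `D` agrees with `U`, so `w` stays private. It is not in
      -- `D` itself, being adjacent to `x` in `U`.
      ...     | no w∉K = w , only wx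
        where
        only : Near A w x → ∀ y → y ∈ D → Near A w y → y ≡ x
        only (inj₁ refl) y y∈D near        = contradiction x∈K w∉K
        only (inj₂ e)    y y∈D (inj₁ refl) = ⊥-elim (outK y∈D w∉K (inK x∈D x∈K) e)
        only (inj₂ _)    y y∈D (inj₂ e)    = unique y (inK y∈D (adjacent-outside w∉K e)) (inj₂ e)

      extensible : ExtensionDS A U
      extensible = D , minimal dominating private-neighbour , λ u∈U → ∈⟪⟫⁺ chosen? (inj₁ u∈U)

    irredundant⇒extensible : ∀ {U} → Irredundant A U → ExtensionDS A U
    irredundant⇒extensible {U} irr with any? (λ k → (k ∈? U) ×-dec (k ∈? K))
    ... | yes (k , k∈U , k∈K) = Meeting.extensible irr k∈U k∈K
    ... | no U∩K=∅ with any? (λ k → (k ∈? K) ×-dec ¬? (any? (λ i → ¬? (i ∈? K) ×-dec (A k i Bool.≟ true))))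
    ...   | no all-covered = D , minimal dominating alone , λ u∈U → ∈⟪⟫⁺ out? (λ u∈K → U∩K=∅ (_ , u∈U , u∈K))
      where
      out? : Decidable (_∉ K)
      out? v = ¬? (v ∈? K)
      D : Subset n
      D = ⟪ out? ⟫
      dominating : IsDominating A D
      dominating v with v ∈? K
      ... | no v∉K = inj₁ (∈⟪⟫⁺ out? v∉K)
      ... | yes v∈K with any? (λ i → ¬? (i ∈? K) ×-dec (A v i Bool.≟ true))
      ...   | yes (i , i∉K , e) = dominated (∈⟪⟫⁺ out? i∉K) (inj₂ e)
      ...   | no ne = ⊥-elim (all-covered (v , v∈K , ne))
      alone : ∀ x → x ∈ D → ∃[ w ] (∀ y → y ∈ D → Near A w y → y ≡ x)
      alone x x∈D = x , λ where
        y y∈D (inj₁ eq) → sym eq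
        y y∈D (inj₂ e)  → ⊥-elim (∈⟪⟫⁻ out? y∈D (adjacent-outside (∈⟪⟫⁻ out? x∈D) e))
    -- `U` lies in the independent part and `k` has no neighbour there, so `U′` is independent and
    -- each of its vertices is private to itself. As `U′` contains `k`, the case of a set meeting
    -- the clique applies.
    ...   | yes (k , k∈K , uncovered) =
      let (D , min , U′⊆D) = Meeting.extensible self-private (∈⟪⟫⁺ with-k? (inj₂ refl)) k∈K
      in D , min , λ u∈U → U′⊆D (∈⟪⟫⁺ with-k? (inj₁ u∈U))
      where
      with-k? : Decidable (λ v → v ∈ U ⊎ v ≡ k)
      with-k? v = (v ∈? U) ⊎-dec (v ≟ k)
      U′ : Subset n
      U′ = ⟪ with-k? ⟫
      U∌ : ∀ {v} → v ∈ U → v ∉ K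
      U∌ v∈U v∈K = U∩K=∅ (_ , v∈U , v∈K)
      non-adjacent : ∀ {u v} → u ∈ U ⊎ u ≡ k → v ∈ U ⊎ v ≡ k → A u v ≢ true
      non-adjacent (inj₁ u∈U)  (inj₁ v∈U)  e = U∌ v∈U (adjacent-outside (U∌ u∈U) e)
      non-adjacent (inj₁ u∈U)  (inj₂ refl) e = uncovered (_ , U∌ u∈U , flip e)
      non-adjacent (inj₂ refl) (inj₁ v∈U)  e = uncovered (_ , U∌ v∈U , e)
      non-adjacent (inj₂ refl) (inj₂ refl) e = irreflexive e
      self-private : Irredundant A U′
      self-private u u∈ = u , inj₁ refl , λ where
        j j∈ (inj₁ eq) → sym eq
        j j∈ (inj₂ e)  → ⊥-elim (non-adjacent (∈⟪⟫⁻ with-k? u∈) (∈⟪⟫⁻ with-k? j∈) e)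

-- Sweeping machines

-- Lets control states be structured data: the Turing machine decodes its state number, takes a
-- transition and encodes the result.
record Finite (S : Set) : Set where
  field
    size        : ℕ
    code        : S → Fin size
    decode      : Fin size → S
    decode-code : ∀ s → decode (code s) ≡ s

  code-injective : ∀ {s s′} → code s ≡ code s′ → s ≡ s′
  code-injective {s} {s′} eq = trans (sym (decode-code s)) (trans (cong decode eq) (decode-code s′))

open Finite using (size; code; decode; decode-code)

Fin-finite : ∀ n → Finite (Fin n)
Fin-finite n = record { size = n ; code = λ i → i ; decode = λ i → i ; decode-code = λ _ → refl }

retract-finite : ∀ {S T : Set} (f : S → T) (g : T → S) → (∀ s → g (f s) ≡ s) → Finite T → Finite S
retract-finite f g gf F = record
  { size = size F ; code = λ s → code F (f s) ; decode = λ i → g (decode F i)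
  ; decode-code = λ s → trans (cong g (decode-code F (f s))) (gf s) }

⊎-finite : ∀ {S T : Set} → Finite S → Finite T → Finite (S ⊎ T)
⊎-finite F G = record
  { size = size F + size G
  ; code = λ x → join (size F) (size G) (Sum.map (code F) (code G) x)
  ; decode = λ i → Sum.map (decode F) (decode G) (splitAt (size F) i)
  ; decode-code = λ x → trans (cong (Sum.map (decode F) (decode G)) (splitAt-join (size F) (size G) (Sum.map (code F) (code G) x))) (cancel x) }
  where
  cancel : ∀ x → Sum.map (decode F) (decode G) (Sum.map (code F) (code G) x) ≡ x
  cancel (inj₁ s) = cong inj₁ (decode-code F s)
  cancel (inj₂ t) = cong inj₂ (decode-code G t)

×-finite : ∀ {S T : Set} → Finite S → Finite T → Finite (S × T)
×-finite F G = record
  { size = size F * size G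
  ; code = λ (s , t) → combine (code F s) (code G t)
  ; decode = λ i → let (a , b) = remQuot (size G) i in decode F a , decode G b
  ; decode-code = λ (s , t) → trans (cong (λ (a , b) → decode F a , decode G b) (remQuot-combine (code F s) (code G t)))
                                    (cong₂ _,_ (decode-code F s) (decode-code G t)) }

bool : Fin 2 → Bool
bool zero    = false
bool (suc _) = true

unbool : Bool → Fin 2
unbool false = zero
unbool true  = suc zero

Bool-finite : Finite Bool
Bool-finite = retract-finite unbool bool (λ { false → refl ; true → refl }) (Fin-finite 2)

-- The non-blank symbols 0, 1, # are the images of O, I, H under suc : Fin 3 → Sym.
Γ : Set
Γ = Fin 3

pattern O = zero
pattern I = suc zero
pattern H = suc (suc zero)

data End (S : Set) : Set where
  emit : Γ → S → End S
  turn : S → End S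
  halt : Bool → End S

-- A sweeper repeatedly traverses the non-blank content of the tape from left
-- to right as a finite transducer; behind the last cell it may append
-- symbols, and then either halts or returns to the left end.
record Sweeper : Set₁ where
  field
    S      : Set
    finite : Finite S
    start  : S
    δ      : S → Γ → S × Sym
    end    : S → End S

step-≡ : ∀ (M : TM) {q x q′ o d ls rs} → halted? M q ≡ false → TM.δ M q x ≡ (q′ , o , d) →
         step M (cfg q ls x rs) ≡ move M q′ o d ls rs
step-≡ M {ls = ls} {rs} e₁ e₂ rewrite e₁ = cong (λ (q′ , o , d) → move M q′ o d ls rs) e₂

-- From sweepers to Turing machines

module Machine (W : Sweeper) where
  open Sweeper W

  Control : Set
  Control = S ⊎ S ⊎ Bool

  pattern forth s = inj₁ s
  pattern back s  = inj₂ (inj₁ s)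
  pattern stop b  = inj₂ (inj₂ b)

  control : Finite Control
  control = ⊎-finite finite (⊎-finite finite Bool-finite)

  atEnd : End S → Control × Sym × Dir
  atEnd (emit γ s) = forth s , suc γ , right
  atEnd (turn s)   = back s , blank , left
  atEnd (halt b)   = stop b , blank , left

  -- A blank tells `forth` that the content ends on the right and `back` that it ends on the left.
  -- So the content must be free of blanks, and only its first cell can be erased safely.
  δᶜ : Control → Sym → Control × Sym × Dir
  δᶜ (forth s) zero    = atEnd (end s)
  δᶜ (forth s) (suc γ) = let (s′ , o) = δ s γ in forth s′ , o , right
  δᶜ (back s)  zero    = forth s , blank , right
  δᶜ (back s)  (suc γ) = back s , suc γ , left
  δᶜ (stop b)  x       = stop b , x , left

  ⌜_⌝ : Control → Fin (size control)
  ⌜_⌝ = code control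

  machine : TM
  machine = record
    { Q      = size control
    ; start  = ⌜ forth start ⌝
    ; accept = ⌜ stop true ⌝
    ; reject = ⌜ stop false ⌝
    ; δ      = λ q x → map₁ ⌜_⌝ (δᶜ (decode control q) x) }

  Active : Control → Set
  Active q = ∀ b → q ≢ stop b

  halted?-active : ∀ {q} → Active q → halted? machine ⌜ q ⌝ ≡ false
  halted?-active {q} act with ⌜ q ⌝ ≟ ⌜ stop true ⌝
  ... | yes eq = ⊥-elim (act true (Finite.code-injective control eq))
  ... | no _ with ⌜ q ⌝ ≟ ⌜ stop false ⌝
  ...   | yes eq = ⊥-elim (act false (Finite.code-injective control eq))
  ...   | no _ = refl

  step-active : ∀ {q x q′ o d ls rs} → Active q → δᶜ q x ≡ (q′ , o , d) →
                step machine (cfg ⌜ q ⌝ ls x rs) ≡ move machine ⌜ q′ ⌝ o d ls rs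
  step-active {q} {x} act eq = step-≡ machine (halted?-active act)
    (cong (map₁ ⌜_⌝) (trans (cong (λ p → δᶜ p x) (decode-code control q)) eq))

  forth-active : ∀ {s} → Active (forth s)
  forth-active b ()

  back-active : ∀ {s} → Active (back s)
  back-active b ()

  -- The head is on the first cell of the right part in at, and on the first
  -- cell of the left part in atˡ.
  at atˡ : Control → List Sym → List Sym → Config machine
  at q ls []        = cfg ⌜ q ⌝ ls blank []
  at q ls (r ∷ rs)  = cfg ⌜ q ⌝ ls r rs
  atˡ q []       rs = cfg ⌜ q ⌝ [] blank rs
  atˡ q (l ∷ ls) rs = cfg ⌜ q ⌝ ls l rs

  move-right : ∀ q o ls rs → move machine ⌜ q ⌝ o right ls rs ≡ at q (o ∷ ls) rs
  move-right q o ls []       = refl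
  move-right q o ls (r ∷ rs) = refl

  move-left : ∀ q o ls rs → move machine ⌜ q ⌝ o left ls rs ≡ atˡ q ls (o ∷ rs)
  move-left q o []       rs = refl
  move-left q o (l ∷ ls) rs = refl

  infix 4 _⟶[_]_
  record _⟶[_]_ (c : Config machine) (t : ℕ) (c′ : Config machine) : Set where
    constructor ⟨_⟩
    field reached : run machine t c ≡ c′
  open _⟶[_]_

  infixr 5 _⨾_
  _⨾_ : ∀ {c d e m n} → c ⟶[ m ] d → d ⟶[ n ] e → c ⟶[ m + n ] e
  _⨾_ {m = zero}  ⟨ refl ⟩ q = q
  _⨾_ {m = suc m} ⟨ p ⟩ q = ⟨ reached (⟨_⟩ {t = m} p ⨾ q) ⟩

  blanks : ℕ → List Sym
  blanks k = replicate k blank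

  at-blanks : ∀ q ls k → at q ls (blanks k) ≡ cfg ⌜ q ⌝ ls blank (blanks (pred k))
  at-blanks q ls zero    = refl
  at-blanks q ls (suc k) = refl

  -- The returning head needs a blank just left of the content in order to bounce; an unvisited cell
  -- serves as well as a written blank.
  data BlankLeft : List Sym → Set where
    []     : BlankLeft []
    blank∷ : ∀ ls → BlankLeft (blank ∷ ls)

  data Pass : S → List Γ → S → List Γ → Set where
    []     : ∀ {s} → Pass s [] s []
    cons : ∀ {s s₁ s′ γ γ′ w w′} → δ s γ ≡ (s₁ , suc γ′) → Pass s₁ w s′ w′ → Pass s (γ ∷ w) s′ (γ′ ∷ w′)

  infixr 5 _++ᴾ_
  _++ᴾ_ : ∀ {s s₁ s₂ w w₁ v v₁} → Pass s w s₁ w₁ → Pass s₁ v s₂ v₁ → Pass s (w ++ v) s₂ (w₁ ++ v₁)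
  []        ++ᴾ q = q
  cons e p  ++ᴾ q = cons e (p ++ᴾ q)

  data Emits : S → List Γ → S → Set where
    []   : ∀ {s} → Emits s [] s
    cons : ∀ {s s₁ s′ γ e} → end s ≡ emit γ s₁ → Emits s₁ e s′ → Emits s (γ ∷ e) s′

  -- `pop` consumes the first cell, which together with appending makes the content a queue. The
  -- bound 3 is the width of a column, the most that the program appends in one sweep.
  data Sweep : S → List Γ → S → List Γ → Set where
    keep : ∀ {s w s₁ w₁ s₂ e s′} → Pass s w s₁ w₁ → Emits s₁ e s₂ → end s₂ ≡ turn s′ →
           length e ≤ 3 → Sweep s w s′ (w₁ ++ e)
    pop  : ∀ {s γ s₀ w s₁ w₁ s₂ e s′} → δ s γ ≡ (s₀ , blank) → Pass s₀ w s₁ w₁ → Emits s₁ e s₂ →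
           end s₂ ≡ turn s′ → length e ≤ 3 → Sweep s (γ ∷ w) s′ (w₁ ++ e)

  infixr 5 _∷_ _++ˢ_
  data Sweeps : ℕ → S → List Γ → S → List Γ → Set where
    []  : ∀ {s w} → Sweeps 0 s w s w
    _∷_ : ∀ {N s w s₁ w₁ s′ w′} → Sweep s w s₁ w₁ → Sweeps N s₁ w₁ s′ w′ → Sweeps (suc N) s w s′ w′

  _++ˢ_ : ∀ {M N s w s₁ w₁ s′ w′} → Sweeps M s w s₁ w₁ → Sweeps N s₁ w₁ s′ w′ → Sweeps (M + N) s w s′ w′
  []      ++ˢ q = q
  (x ∷ p) ++ˢ q = x ∷ (p ++ˢ q)

  length-Pass : ∀ {s w s′ w′} → Pass s w s′ w′ → length w′ ≡ length w
  length-Pass []         = refl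
  length-Pass (cons _ p) = cong suc (length-Pass p)

  -- Executing sweeps and counting steps

  step-forth : ∀ {s γ s′ o ls rs} → δ s γ ≡ (s′ , o) →
               at (forth s) ls (suc γ ∷ rs) ⟶[ 1 ] at (forth s′) (o ∷ ls) rs
  step-forth {s} {γ} {o = o} {ls} {rs} eq = ⟨ trans
    (step-active {x = suc γ} forth-active (cong (λ (s′ , o) → forth s′ , o , right) eq)) (move-right _ o ls rs) ⟩

  step-back : ∀ {s γ ls rs} → atˡ (back s) (suc γ ∷ ls) rs ⟶[ 1 ] atˡ (back s) ls (suc γ ∷ rs)
  step-back {s} {γ} {ls} {rs} = ⟨ trans (step-active {x = suc γ} (back-active {s}) refl) (move-left (back s) (suc γ) ls rs) ⟩

  step-end : ∀ {s ls a} k → end s ≡ a → let (q , o , d) = atEnd a in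
             at (forth s) ls (blanks k) ⟶[ 1 ] move machine ⌜ q ⌝ o d ls (blanks (pred k))
  step-end {s} {ls} k eq = ⟨ trans (cong (step machine) (at-blanks (forth s) ls k))
                                   (step-active forth-active (cong atEnd eq)) ⟩

  infixl 4 _▸_
  _▸_ : ∀ {c t d e} → c ⟶[ t ] d → d ≡ e → c ⟶[ t ] e
  p ▸ refl = p

  run-pass : ∀ {s w s′ w′ ls rs} → Pass s w s′ w′ →
             at (forth s) ls (map suc w ++ rs) ⟶[ length w ] at (forth s′) (map suc w′ ʳ++ ls) rs
  run-pass []          = ⟨ refl ⟩
  run-pass (cons eq p) = step-forth eq ⨾ run-pass p

  run-emits : ∀ {s e s′ ls} k → Emits s e s′ →
              ∃[ k′ ] at (forth s) ls (blanks k) ⟶[ length e ] at (forth s′) (map suc e ʳ++ ls) (blanks k′)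
  run-emits k [] = k , ⟨ refl ⟩
  run-emits k (cons eq es) =
    map₂ ((step-end k eq ▸ move-right _ _ _ (blanks (pred k))) ⨾_) (run-emits (pred k) es)

  run-turn : ∀ {s s′ ls} k → end s ≡ turn s′ →
             at (forth s) ls (blanks k) ⟶[ 1 ] atˡ (back s′) ls (blanks (suc (pred k)))
  run-turn {ls = ls} k eq = step-end k eq ▸ move-left _ blank ls _

  run-back : ∀ {s ls rs} v → atˡ (back s) (map suc v ʳ++ ls) rs ⟶[ length v ] atˡ (back s) ls (map suc v ++ rs)
  run-back []                    = ⟨ refl ⟩
  run-back {s} {ls} {rs} (γ ∷ v) = subst (λ t → atˡ (back s) (map suc v ʳ++ (suc γ ∷ ls)) rs ⟶[ t ] atˡ (back s) ls (suc γ ∷ map suc v ++ rs))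
    (+-comm (length v) 1) (run-back v ⨾ step-back)

  run-bounce : ∀ {s ls rs} → BlankLeft ls →
               ∃[ ls′ ] atˡ (back s) ls rs ⟶[ 1 ] at (forth s) (blank ∷ ls′) rs
  run-bounce {s} {rs = rs} []     = [] , ⟨ trans (step-active (back-active {s}) refl) (move-right (forth s) blank [] rs) ⟩
  run-bounce {s} {rs = rs} (blank∷ ls) = ls , ⟨ trans (step-active (back-active {s}) refl) (move-right (forth s) blank ls rs) ⟩

  -- `padding` counts the explicit blanks to the right: turning around leaves one in the list, so
  -- the tape is determined by its content only up to trailing blanks.
  record Ready (s : S) (w : List Γ) (c : Config machine) : Set where
    constructor ready
    field
      {before} : List Sym
      padding  : ℕ
      isBlank  : BlankLeft before
      position : c ≡ at (forth s) before (map suc w ++ blanks padding)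

  infix 4 _⟶[≤_]_,_
  _⟶[≤_]_,_ : Config machine → ℕ → S → List Γ → Set
  c ⟶[≤ T ] s , w = ∃[ t ] ∃[ d ] (t ≤ T × Ready s w d × c ⟶[ t ] d)

  -- The summands are the costs of the forward pass, the appending, the turn, the way back and the
  -- bounce. Both kinds of sweep end like this; `pop` makes one erasing step before it.
  run-rest : ∀ {s w s₁ w₁ s₂ e s′ ls} k → Pass s w s₁ w₁ → Emits s₁ e s₂ → end s₂ ≡ turn s′ → BlankLeft ls →
    ∃[ d ] (Ready s′ (w₁ ++ e) d ×
      at (forth s) ls (map suc w ++ blanks k) ⟶[ length w + (length e + (1 + (length (w₁ ++ e) + 1))) ] d)
  run-rest {w₁ = w₁} {e = e} {s′ = s′} {ls = ls} k p es eq bl =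
    let (k′ , emitted) = run-emits k es
        (ls′ , bounced) = run-bounce bl
    in _ , ready (suc (pred k′)) (blank∷ ls′) refl ,
       run-pass p ⨾ emitted ⨾ (run-turn k′ eq ▸ cong (λ z → atˡ (back s′) z (blanks (suc (pred k′)))) split)
         ⨾ run-back (w₁ ++ e) ⨾ bounced
    where
    split : map suc e ʳ++ (map suc w₁ ʳ++ ls) ≡ map suc (w₁ ++ e) ʳ++ ls
    split = trans (sym (++-ʳ++ (map suc w₁))) (cong (_ʳ++ ls) (sym (map-++ suc w₁ e)))

  rest-time : ∀ {a b c} → a ≡ b → c ≤ 3 → b + (c + (1 + ((a + c) + 1))) ≤ 2 * b + 8
  rest-time {a} {b} {c} refl c≤3 = begin
    a + (c + (1 + ((a + c) + 1))) ≡⟨ +-*-Solver.solve 2 (λ a c → a :+ (c :+ (con 1 :+ ((a :+ c) :+ con 1))) := con 2 :* a :+ (con 2 :+ con 2 :* c)) refl a c ⟩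
    2 * a + (2 + 2 * c)           ≤⟨ +-monoʳ-≤ (2 * a) (+-monoʳ-≤ 2 (*-monoʳ-≤ 2 c≤3)) ⟩
    2 * a + 8                     ∎
    where
    open ≤-Reasoning
    open +-*-Solver

  run-sweep : ∀ {s w s′ w′ c} → Sweep s w s′ w′ → Ready s w c →
              length w′ ≤ length w + 3 × c ⟶[≤ 2 * length w + 8 ] s′ , w′
  run-sweep {w = w} (keep {w₁ = w₁} {e = e} p es eq e≤3) (ready k bl refl) =
    let (d , r , reach) = run-rest k p es eq bl
    in subst (_≤ length w + 3) (sym |w₁e|) (+-mono-≤ (≤-reflexive (length-Pass p)) e≤3) ,
       _ , d , subst (λ z → length w + (length e + (1 + (z + 1))) ≤ 2 * length w + 8) (sym |w₁e|)
                 (rest-time (length-Pass p) e≤3) ,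
       r , reach
    where
    |w₁e| : length (w₁ ++ e) ≡ length w₁ + length e
    |w₁e| = length-++ w₁
  -- The erased cell is the new left border, which is why the rest runs with `blank∷ ls` on its
  -- left.
  run-sweep (pop {w = w} {w₁ = w₁} {e = e} eq₀ p es eq e≤3) (ready {ls} k bl refl) =
    let (d , r , reach) = run-rest k p es eq (blank∷ ls)
    in subst (_≤ suc (length w) + 3) (sym |w₁e|)
         (+-mono-≤ (≤-trans (≤-reflexive (length-Pass p)) (n≤1+n _)) e≤3) ,
       _ , d , ≤-trans (s≤s (subst (λ z → length w + (length e + (1 + (z + 1))) ≤ 2 * length w + 8) (sym |w₁e|)
                              (rest-time (length-Pass p) e≤3)))
                       (+-monoˡ-≤ 8 (s≤s (+-monoʳ-≤ (length w) (n≤1+n (length w + 0))))) ,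
       r , (step-forth eq₀ ⨾ reach)
    where
    |w₁e| : length (w₁ ++ e) ≡ length w₁ + length e
    |w₁e| = length-++ w₁

  -- A sweep lengthens the content by at most 3, so `length w + 3 * N` bounds the length throughout,
  -- and each sweep is charged the cost for that length.
  run-sweeps : ∀ {N s w s′ w′ c} → Sweeps N s w s′ w′ → Ready s w c →
    length w′ ≤ length w + 3 * N × c ⟶[≤ N * (2 * (length w + 3 * N) + 8) ] s′ , w′
  run-sweeps {w = w} [] r = m≤m+n (length w) 0 , 0 , _ , z≤n , r , ⟨ refl ⟩
  run-sweeps {suc N} {w = w} (_∷_ {w₁ = w₁} x xs) r =
    let (|w₁| , t₁ , d₁ , t₁≤ , r₁ , reach₁) = run-sweep x r
        (|w′| , t₂ , d₂ , t₂≤ , r₂ , reach₂) = run-sweeps xs r₁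
        grow : length w₁ + 3 * N ≤ length w + 3 * suc N
        grow = ≤-trans (+-monoˡ-≤ (3 * N) |w₁|) (≤-reflexive
          (solve 2 (λ l n → (l :+ con 3) :+ con 3 :* n := l :+ con 3 :* (con 1 :+ n)) refl (length w) N))
    in ≤-trans |w′| grow , t₁ + t₂ , d₂ ,
       +-mono-≤ (≤-trans t₁≤ (+-monoˡ-≤ 8 (*-monoʳ-≤ 2 (m≤m+n (length w) (3 * suc N)))))
                (≤-trans t₂≤ (*-monoʳ-≤ N (+-monoˡ-≤ 8 (*-monoʳ-≤ 2 grow)))) ,
       r₂ , (reach₁ ⨾ reach₂)
    where
    open +-*-Solver

  record Decides (N : ℕ) (w : List Γ) (b : Bool) : Set where
    field
      {last}      : S
      {content}   : List Γ
      {final}     : S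
      {residue}   : List Γ
      sweeps      : Sweeps N start w last content
      lastPass    : Pass last content final residue
      halts       : end final ≡ halt b

  outcome-stop : ∀ x t b → Config.state (run machine t (initial machine x)) ≡ ⌜ stop b ⌝ → outcome machine x t ≡ just b
  outcome-stop x t true eq with ⌜ stop true ⌝ ≟ ⌜ stop true ⌝ in dec
  ... | yes _ rewrite eq | dec = refl
  ... | no ne = ⊥-elim (ne refl)
  outcome-stop x t false eq with ⌜ stop false ⌝ ≟ ⌜ stop true ⌝ in dec₁ | ⌜ stop false ⌝ ≟ ⌜ stop false ⌝ in dec₂
  ... | yes e | _ = ⊥-elim (false≢true (Finite.code-injective control e))
    where
    false≢true : ¬ (_≡_ {A = Control} (stop false) (stop true))
    false≢true ()
  ... | no _ | no ne = ⊥-elim (ne refl)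
  ... | no _ | yes _ rewrite eq | dec₁ | dec₂ = refl

  initial-at : ∀ x → initial machine x ≡ at (forth start) [] x
  initial-at []      = refl
  initial-at (_ ∷ _) = refl

  -- The final pass, which halts instead of turning, is charged as one more sweep; hence `suc N`.
  decide : ∀ {N w b} → Decides N w b →
           ∃[ t ] (t ≤ suc N * (2 * (length w + 3 * suc N) + 8) × outcome machine (map suc w) t ≡ just b)
  decide {N} {w} {b} d with run-sweeps (Decides.sweeps d)
                              (ready 0 [] (trans (initial-at _) (cong (at (forth start) []) (sym (++-identityʳ _)))))
  ... | |v| , t , _ , t≤ , ready {ls} k _ refl , reach =
    t + (length content + 1) , (begin
      t + (length content + 1)
        ≤⟨ +-mono-≤ t≤ (+-mono-≤ |v| (s≤s z≤n)) ⟩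
      N * (2 * (length w + 3 * N) + 8) + ((length w + 3 * N) + 8)
        ≤⟨ +-mono-≤ (*-monoʳ-≤ N (+-monoˡ-≤ 8 (*-monoʳ-≤ 2 grow)))
                    (+-monoˡ-≤ 8 (≤-trans grow (m≤m+n _ _))) ⟩
      N * (2 * (length w + 3 * suc N) + 8) + (2 * (length w + 3 * suc N) + 8)
        ≡⟨ +-comm (N * (2 * (length w + 3 * suc N) + 8)) _ ⟩
      suc N * (2 * (length w + 3 * suc N) + 8) ∎) ,
    outcome-stop (map suc w) (t + (length content + 1)) b
      (trans (cong Config.state (reached (reach ⨾ run-pass lastPass ⨾ (step-end k halts ▸ move-left (stop b) blank _ _))))
             (state-atˡ (map suc residue ʳ++ ls)))
    where
    open Decides d
    open ≤-Reasoning hiding (start; stop)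
    grow : length w + 3 * N ≤ length w + 3 * suc N
    grow = +-monoʳ-≤ (length w) (*-monoʳ-≤ 3 (n≤1+n N))
    state-atˡ : ∀ {q rs} ls → Config.state (atˡ q ls rs) ≡ ⌜ q ⌝
    state-atˡ []      = refl
    state-atˡ (_ ∷ _) = refl

-- The sweeping program

-- After the rotation phases the tape holds the unread bits of A, a #, and one
-- column of three cells (d, h, x) per vertex: d is 1 in the column of the row
-- being read (so that the row is read as N[w]); h is # until the bit of the
-- current row is copied there; x is 0 outside U, 1 in U, # in U and served.
-- In the phases a is the bit being delivered, c the number of hits in the row
-- so far, k the value of d shifted in from the previous column, and u tells
-- whether the hit of the finished row is to be served.
Phase : Set
Phase = Fin 9 ⊎ (Fin 7 × Γ) ⊎ (Fin 5 × Γ × Γ) ⊎ (Fin 3 × Γ × Γ × Γ)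

pattern mark           = inj₁ 0F
pattern rotateA        = inj₁ 1F
pattern rotateU        = inj₁ 2F
pattern nextBit        = inj₁ 3F
pattern checkD         = inj₁ 4F
pattern checkH         = inj₁ 5F
pattern checkX         = inj₁ 6F
pattern unserved       = inj₁ 7F
pattern toReset        = inj₁ 8F
pattern copy γ         = inj₂ (inj₁ (0F , γ))
pattern carryA γ       = inj₂ (inj₁ (1F , γ))
pattern carryU γ       = inj₂ (inj₁ (2F , γ))
pattern carryU′ γ      = inj₂ (inj₁ (3F , γ))
pattern carryU″ γ      = inj₂ (inj₁ (4F , γ))
pattern seek a         = inj₂ (inj₁ (5F , a))
pattern full c         = inj₂ (inj₁ (6F , c))
pattern colD a c       = inj₂ (inj₂ (inj₁ (0F , a , c)))
pattern hitX c h       = inj₂ (inj₂ (inj₁ (1F , c , h)))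
pattern reset k u      = inj₂ (inj₂ (inj₁ (2F , k , u)))
pattern resetD k u     = inj₂ (inj₂ (inj₁ (3F , k , u)))
pattern resetH k u     = inj₂ (inj₂ (inj₁ (4F , k , u)))
pattern colH a c d     = inj₂ (inj₂ (inj₂ (0F , a , c , d)))
pattern colX a c h     = inj₂ (inj₂ (inj₂ (1F , a , c , h)))
pattern resetX k u h   = inj₂ (inj₂ (inj₂ (2F , k , u , h)))
-- `copy γ` leaves the rest of the tape as it is; `γ` only remembers which sweep comes next.
pattern toRotateA      = copy O
pattern toRotateU      = copy I
pattern toNextBit      = copy H

bit : Bool → Γ
bit false = O
bit true  = I

infixr 6 _or_
_or_ : Γ → Γ → Γ
I or _ = I
_ or I = I
_ or _ = O

-- Counts 0, 1, ≥ 2 are represented by O, I, H.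
tally : Γ → Γ → Γ → Γ
tally c I O = c
tally O I _ = I
tally _ I _ = H
tally c _ _ = c

single : Γ → Γ
single I = I
single _ = O

serve : Γ → Γ → Γ → Γ
serve I I I = H
serve _ _ x = x

δ : Phase → Γ → Phase × Sym
δ rotateA        γ = carryA γ , blank
-- This # is the one appended by `mark`. Once it is at the front, the bits of A come first again,
-- followed by # and the finished columns.
δ rotateU        H = toReset , blank
δ rotateU        γ = carryU γ , blank
δ nextBit        H = checkD , suc H
δ nextBit        a = seek a , blank
δ (seek a)       H = colD a O , suc H
δ (colD a c)     d = colH a c d , suc d
-- The first h still equal to # shows the column that is due for the bit. The disjunction with d
-- puts the vertex of the row into its own neighbourhood.
δ (colH a c d)   H = hitX c (a or d) , suc (a or d)
δ (colH a c d)   h = colX a c h , suc h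
δ (colX a c h)   x = colD a (tally c h x) , suc x
δ (hitX c h)     x = full (tally c h x) , suc x
-- Any symbol after the column just filled means that the row is incomplete, and the count is
-- dropped. If the tape ends here instead, `c` counts the whole row.
δ (full c)       γ = toNextBit , suc γ
δ (reset k u)    H = resetD k u , suc H
-- Each d is replaced by its left neighbour's, so the 1 moves on to the column of the next row.
δ (resetD k u)   d = resetH d u , suc k
δ (resetH k u)   h = resetX k u h , suc H
δ (resetX k u h) x = resetD k u , suc (serve u h x)
δ checkD         γ = checkH , suc γ
δ checkH         γ = checkX , suc γ
δ checkX         I = unserved , suc I
δ checkX         γ = checkD , suc γ
δ s              γ = s , suc γ

end : Phase → End Phase
end mark         = emit H toRotateA
end (carryA H)   = emit H toRotateU
end (carryA γ)   = emit γ toRotateA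
end (carryU γ)   = emit O (carryU′ γ)
end (carryU′ γ)  = emit H (carryU″ γ)
end (carryU″ γ)  = emit γ toRotateU
end toRotateA    = turn rotateA
end toRotateU    = turn rotateU
end toNextBit    = turn nextBit
end toReset      = turn (reset I O)
end (full c)     = turn (reset O (single c))
end (resetD k u) = turn nextBit
end checkD       = halt true
end _            = halt false

sweeper : Sweeper
sweeper = record
  { S      = Phase
  ; finite = ⊎-finite (Fin-finite 9) (⊎-finite (×-finite (Fin-finite 7) Γ-finite)
               (⊎-finite (×-finite (Fin-finite 5) (×-finite Γ-finite Γ-finite))
                         (×-finite (Fin-finite 3) (×-finite Γ-finite (×-finite Γ-finite Γ-finite)))))
  ; start  = mark
  ; δ      = δ
  ; end    = end }
  where
  Γ-finite : Finite Γ
  Γ-finite = Fin-finite 3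

open Machine sweeper

infixl 6 _▹_ _▹ˢ_
_▹_ : ∀ {s w s′ w₁ w₂} → Sweep s w s′ w₁ → w₁ ≡ w₂ → Sweep s w s′ w₂
p ▹ refl = p

_▹ˢ_ : ∀ {N s w s′ w₁ w₂} → Sweeps N s w s′ w₁ → w₁ ≡ w₂ → Sweeps N s w s′ w₂
p ▹ˢ refl = p

recount : ∀ {M N s w s′ w′} → M ≡ N → Sweeps M s w s′ w′ → Sweeps N s w s′ w′
recount refl p = p

keep₀ : ∀ {s w s₁ w₁ s′} → Pass s w s₁ w₁ → end s₁ ≡ turn s′ → Sweep s w s′ w₁
keep₀ p eq = keep p [] eq z≤n ▹ ++-identityʳ _

pop₀ : ∀ {s γ s₀ w s₁ w₁ s′} → δ s γ ≡ (s₀ , blank) → Pass s₀ w s₁ w₁ → end s₁ ≡ turn s′ → Sweep s (γ ∷ w) s′ w₁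
pop₀ e p eq = pop e p [] eq z≤n ▹ ++-identityʳ _

copying : ∀ {s} → (∀ γ → δ s γ ≡ (s , suc γ)) → ∀ w → Pass s w s w
copying e []      = []
copying e (γ ∷ w) = cons (e γ) (copying e w)

-- Rotating the input into columns

Column : Set
Column = Γ × Γ × Γ

columns : List Column → List Γ
columns []                   = []
columns ((d , h , x) ∷ cs) = d ∷ h ∷ x ∷ columns cs

≢H : Γ → Set
≢H γ = γ ≢ H

bit≢H : ∀ b → ≢H (bit b)
bit≢H false ()
bit≢H true  ()

fresh : Bool → Column
fresh b = O , H , bit b

marking : ∀ w → Sweep mark w rotateA (w ++ [ H ])
marking w = keep (copying (λ _ → refl) w) (cons refl []) refl (s≤s z≤n)

rotatingA : ∀ bs v → Sweeps (length bs) rotateA (map bit bs ++ v) rotateA (v ++ map bit bs)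
rotatingA [] v = [] ▹ˢ sym (++-identityʳ v)
rotatingA (b ∷ bs) v =
  (moveBit b ▹ ++-assoc (map bit bs) v [ bit b ]) ∷
  (rotatingA bs (v ++ [ bit b ]) ▹ˢ ++-assoc v [ bit b ] (map bit bs))
  where
  moveBit : ∀ b {w} → Sweep rotateA (bit b ∷ w) rotateA (w ++ [ bit b ])
  moveBit false {w} = pop refl (copying (λ _ → refl) w) (cons refl []) refl (s≤s z≤n)
  moveBit true  {w} = pop refl (copying (λ _ → refl) w) (cons refl []) refl (s≤s z≤n)

rotatingSep : ∀ w → Sweep rotateA (H ∷ w) rotateU (w ++ [ H ])
rotatingSep w = pop refl (copying (λ _ → refl) w) (cons refl []) refl (s≤s z≤n)

rotatingU : ∀ bs v → Sweeps (length bs) rotateU (map bit bs ++ v) rotateU (v ++ columns (map fresh bs))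
rotatingU [] v = [] ▹ˢ sym (++-identityʳ v)
rotatingU (b ∷ bs) v =
  (moveBit b ▹ ++-assoc (map bit bs) v _) ∷
  (rotatingU bs (v ++ (O ∷ H ∷ bit b ∷ [])) ▹ˢ ++-assoc v _ (columns (map fresh bs)))
  where
  moveBit : ∀ b {w} → Sweep rotateU (bit b ∷ w) rotateU (w ++ (O ∷ H ∷ bit b ∷ []))
  moveBit false {w} = pop refl (copying (λ _ → refl) w) (cons refl (cons refl (cons refl []))) refl ≤-refl
  moveBit true  {w} = pop refl (copying (λ _ → refl) w) (cons refl (cons refl (cons refl []))) refl ≤-refl

rotatingMark : ∀ w → Sweep rotateU (H ∷ w) (reset I O) w
rotatingMark w = pop₀ refl (copying (λ _ → refl) w) refl

-- Writing C for the columns, the tape reads A # U, then A # U #, # U # A, U # A #, # A # C and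
-- finally A # C.
rotating : ∀ as us → Sweeps (suc (length as + suc (length us + 1))) mark (map bit as ++ H ∷ map bit us)
                       (reset I O) (map bit as ++ H ∷ columns (map fresh us))
rotating as us =
  (marking _ ▹ ++-assoc (map bit as) (H ∷ map bit us) [ H ]) ∷
  (rotatingA as (H ∷ map bit us ++ [ H ]) ++ˢ
   (rotatingSep _ ▹ trans (++-assoc (map bit us ++ [ H ]) (map bit as) [ H ]) (++-assoc (map bit us) [ H ] _)) ∷
   (rotatingU us (H ∷ map bit as ++ [ H ]) ++ˢ
    (rotatingMark _ ▹ ++-assoc (map bit as) [ H ] _) ∷ []))

-- Scanning one row

seeking : ∀ {a w} → All ≢H w → Pass (seek a) w (seek a) w
seeking []                       = []
seeking (_∷_ {x = O} _ ps)       = cons refl (seeking ps)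
seeking (_∷_ {x = I} _ ps)       = cons refl (seeking ps)
seeking (_∷_ {x = H} p _)        = ⊥-elim (p refl)

hits : Γ → List Column → Γ
hits c []                 = c
hits c ((d , h , x) ∷ cs) = hits (tally c h x) cs

hits-++ : ∀ c cs cs′ → hits c (cs ++ cs′) ≡ hits (hits c cs) cs′
hits-++ c []                 cs′ = refl
hits-++ c ((d , h , x) ∷ cs) cs′ = hits-++ (tally c h x) cs cs′

Scanned : Column → Set
Scanned (_ , h , _) = ≢H h

passScanned : ∀ {a c cs cs₁ cs₂ s} → All Scanned cs → Pass (colD a (hits c cs)) (columns cs₁) s (columns cs₂) →
              Pass (colD a c) (columns (cs ++ cs₁)) s (columns (cs ++ cs₂))
passScanned [] p = p
passScanned (_∷_ {x = d , O , x} _ ps) p = cons refl (cons refl (cons refl (passScanned ps p)))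
passScanned (_∷_ {x = d , I , x} _ ps) p = cons refl (cons refl (cons refl (passScanned ps p)))
passScanned (_∷_ {x = d , H , x} q _)  p = ⊥-elim (q refl)

δ-nextBit : ∀ b → δ nextBit (bit b) ≡ (seek (bit b) , blank)
δ-nextBit false = refl
δ-nextBit true  = refl

-- The pass from `full` is left open to cover both uses: for the last column `cs` is empty and the
-- phase stays `full`, for earlier ones the remaining columns are copied.
scanBit : ∀ b {v pre d x cs s s′} → All ≢H v → All Scanned pre →
  Pass (full (tally (hits O pre) (bit b or d) x)) (columns cs) s (columns cs) → end s ≡ turn s′ →
  Sweep nextBit (bit b ∷ v ++ H ∷ columns (pre ++ (d , H , x) ∷ cs))
        s′ (v ++ H ∷ columns (pre ++ (d , bit b or d , x) ∷ cs))
scanBit b v-bits scanned p eq = pop₀ (δ-nextBit b)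
  (seeking v-bits ++ᴾ cons refl (passScanned scanned (cons refl (cons refl (cons refl p))))) eq

or-≢H : ∀ a d → ≢H (a or d)
or-≢H O O ()
or-≢H O I ()
or-≢H O H ()
or-≢H I d ()
or-≢H H O ()
or-≢H H I ()
or-≢H H H ()

Scan : ∀ {n} → (Fin n → Γ) → (Fin n → Γ) → (Fin n → Γ) → List Column
Scan d h x = tabulate (λ i → d i , h i , x i)

unscanned : ∀ {n} → Fin n → Γ
unscanned _ = H

hit : ∀ {n} → (Fin n → Bool) → (Fin n → Γ) → Fin n → Γ
hit a d i = bit (a i) or d i

-- Induction on the columns still to be filled, with the filled ones in `pre` and the later rows in
-- `v`. Every sweep counts anew from `O`, so the sweep for the last bit sees the complete row and
-- its count is passed to the reset.
scanRow : ∀ n (a : Fin (suc n) → Bool) (d x : Fin (suc n) → Γ) pre {v} → All ≢H v → All Scanned pre →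
  Sweeps (suc n) nextBit (tabulate (bit ∘ a) ++ (v ++ H ∷ columns (pre ++ Scan d unscanned x)))
    (reset O (single (hits O (pre ++ Scan d (hit a d) x)))) (v ++ H ∷ columns (pre ++ Scan d (hit a d) x))
scanRow zero a d x pre v-bits scanned =
  scanBit (a 0F) v-bits scanned [] (cong (turn ∘ reset O ∘ single) (sym (hits-++ O pre _))) ∷ []
scanRow (suc n) a d x pre {v} v-bits scanned =
  (subst (λ w → Sweep nextBit (bit (a 0F) ∷ w) nextBit ((bits ++ v) ++ H ∷ columns (pre ++ c ∷ unread))) (++-assoc bits v _)
    (scanBit (a 0F) (++⁺ (tabulate⁺ (bit≢H ∘ a ∘ suc)) v-bits) scanned (cons refl (copying (λ _ → refl) _)) refl)
   ▹ trans (++-assoc bits v _) (cong (λ cs → bits ++ (v ++ H ∷ columns cs)) (sym (++-assoc pre [ c ] unread)))) ∷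
  subst (λ cs → Sweeps (suc n) nextBit (bits ++ (v ++ H ∷ columns ((pre ++ [ c ]) ++ unread)))
                  (reset O (single (hits O cs))) (v ++ H ∷ columns cs)) (++-assoc pre [ c ] _)
    (scanRow n (a ∘ suc) (d ∘ suc) (x ∘ suc) (pre ++ [ c ]) v-bits (++⁺ scanned (or-≢H (bit (a 0F)) (d 0F) ∷ [])))
  where
  bits : List Γ
  bits = tabulate (bit ∘ a ∘ suc)
  c : Column
  c = d 0F , hit a d 0F , x 0F
  unread : List Column
  unread = Scan (d ∘ suc) unscanned (x ∘ suc)

-- Resetting the columns and reading all rows

shift : ∀ {n} → Γ → (Fin n → Γ) → Fin n → Γ
shift k d zero    = k
shift k d (suc i) = shift (d zero) (d ∘ suc) i

skipping : ∀ {k u w} → All ≢H w → Pass (reset k u) w (reset k u) w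
skipping []                       = []
skipping (_∷_ {x = O} _ ps)       = cons refl (skipping ps)
skipping (_∷_ {x = I} _ ps)       = cons refl (skipping ps)
skipping (_∷_ {x = H} p _)        = ⊥-elim (p refl)

passReset : ∀ n k u (d h x : Fin n → Γ) →
  ∃[ k′ ] Pass (resetD k u) (columns (Scan d h x)) (resetD k′ u) (columns (Scan (shift k d) unscanned (λ i → serve u (h i) (x i))))
passReset zero    k u d h x = k , []
passReset (suc n) k u d h x = let (k′ , p) = passReset n (d 0F) u (d ∘ suc) (h ∘ suc) (x ∘ suc) in
  k′ , cons refl (cons refl (cons refl p))

-- Used in two ways: with `k = I` and `u = O` it initialises, putting the 1 into the first column
-- and serving nobody; with `k = O` it finishes a row.
resetting : ∀ {n} k u (d h x : Fin n → Γ) {v} → All ≢H v →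
  Sweep (reset k u) (v ++ H ∷ columns (Scan d h x)) nextBit (v ++ H ∷ columns (Scan (shift k d) unscanned (λ i → serve u (h i) (x i))))
resetting k u d h x v-bits = let (k′ , p) = passReset _ k u d h x in
  keep₀ (skipping v-bits ++ᴾ cons refl p) refl

-- Indexed by a number rather than a `Fin n`, since after the last row the 1 has been shifted out of
-- the columns.
unit : ∀ {n} → ℕ → Fin n → Γ
unit zero    zero    = I
unit zero    (suc i) = O
unit (suc k) zero    = O
unit (suc k) (suc i) = unit k i

shift-O : ∀ {n} (i : Fin n) → shift O (λ _ → O) i ≡ O
shift-O zero    = refl
shift-O (suc i) = shift-O i

shift-I : ∀ {n} (i : Fin n) → shift I (λ _ → O) i ≡ unit 0 i
shift-I zero    = refl
shift-I (suc i) = shift-O i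

shift-unit : ∀ {n} k (i : Fin n) → shift O (unit k) i ≡ unit (suc k) i
shift-unit k       zero    = refl
shift-unit zero    (suc i) = shift-I i
shift-unit (suc k) (suc i) = shift-unit k i

update : ∀ {n} → ℕ → (Fin n → Bool) → (Fin n → Γ) → Fin n → Γ
update k a x i = serve (single (hits O (Scan (unit k) (hit a (unit k)) x))) (hit a (unit k) i) (x i)

updates : ∀ {m n} → ℕ → (Fin m → Fin n → Bool) → (Fin n → Γ) → Fin n → Γ
updates {zero}  k A x = x
updates {suc m} k A x = updates (suc k) (A ∘ suc) (update k (A zero) x)

rowBits : ∀ {m n} → (Fin m → Fin n → Bool) → List Bool
rowBits A = concat (tabulate (λ i → tabulate (A i)))

Scan-cong : ∀ {n} {d d′ : Fin n → Γ} h x → (∀ i → d i ≡ d′ i) → Scan d h x ≡ Scan d′ h x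
Scan-cong h x eq = tabulate-cong (λ i → cong (_, h i , x i) (eq i))

bits≢H : ∀ bs → All ≢H (map bit bs)
bits≢H []       = []
bits≢H (b ∷ bs) = bit≢H b ∷ bits≢H bs

-- A row of `suc n` bits takes one sweep per bit and one reset, hence the factor `suc (suc n)`.
scanRows : ∀ {m n} k (A : Fin m → Fin (suc n) → Bool) x →
  ∃[ d ] Sweeps (m * suc (suc n)) nextBit (map bit (rowBits A) ++ H ∷ columns (Scan (unit k) unscanned x))
                nextBit (H ∷ columns (Scan d unscanned (updates k A x)))
scanRows {zero}  k A x = unit k , []
scanRows {suc m} {n} k A x =
  let (d , later) = scanRows (suc k) (A ∘ suc) (update k (A 0F) x)
  in d , recount (cong (_+ m * suc (suc n)) (+-comm (suc n) 1))
           ((row ++ˢ renew ∷ []) ++ˢ later)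
  where
  rest : List Γ
  rest = map bit (rowBits (A ∘ suc))
  tail : List Γ
  tail = H ∷ columns (Scan (unit k) unscanned x)
  split : map bit (rowBits A) ++ tail ≡ tabulate (bit ∘ A 0F) ++ (rest ++ tail)
  split = trans (cong (_++ tail) (trans (map-++ bit (tabulate (A 0F)) (rowBits (A ∘ suc))) (cong (_++ rest) (map-tabulate (A 0F) bit))))
                (++-assoc (tabulate (bit ∘ A 0F)) rest tail)
  row : Sweeps (suc n) nextBit (map bit (rowBits A) ++ H ∷ columns (Scan (unit k) unscanned x))
          (reset O (single (hits O (Scan (unit k) (hit (A 0F) (unit k)) x))))
          (map bit (rowBits (A ∘ suc)) ++ H ∷ columns (Scan (unit k) (hit (A 0F) (unit k)) x))
  renew : Sweep (reset O (single (hits O (Scan (unit k) (hit (A 0F) (unit k)) x))))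
            (map bit (rowBits (A ∘ suc)) ++ H ∷ columns (Scan (unit k) (hit (A 0F) (unit k)) x))
            nextBit (map bit (rowBits (A ∘ suc)) ++ H ∷ columns (Scan (unit (suc k)) unscanned (update k (A 0F) x)))
  renew = resetting O _ (unit k) (hit (A 0F) (unit k)) x (bits≢H (rowBits (A ∘ suc)))
          ▹ cong (λ cs → map bit (rowBits (A ∘ suc)) ++ H ∷ columns cs) (Scan-cong unscanned (update k (A 0F) x) (shift-unit k))
  row rewrite split = scanRow n (A 0F) (unit k) x [] (bits≢H (rowBits (A ∘ suc))) []

-- The final check and the complete run

checking : ∀ {n} (d h x : Fin n → Γ) →
  ((∀ i → x i ≢ I) × Pass checkD (columns (Scan d h x)) checkD (columns (Scan d h x))) ⊎
  ((∃[ i ] x i ≡ I) × Pass checkD (columns (Scan d h x)) unserved (columns (Scan d h x)))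
checking {zero} d h x = inj₁ ((λ ()) , [])
checking {suc n} d h x with x 0F in eq | checking (d ∘ suc) (h ∘ suc) (x ∘ suc)
... | I | _ = inj₂ ((0F , eq) , cons refl (cons refl (cons refl (copying (λ _ → refl) _))))
... | O | inj₂ ((i , e) , p) = inj₂ ((suc i , e) , cons refl (cons refl (cons refl p)))
... | H | inj₂ ((i , e) , p) = inj₂ ((suc i , e) , cons refl (cons refl (cons refl p)))
... | O | inj₁ (f , p) = inj₁ ((λ { zero e → O≢I (trans (sym eq) e) ; (suc i) → f i }) , cons refl (cons refl (cons refl p)))
  where
  O≢I : ¬ (_≡_ {A = Γ} O I)
  O≢I ()
... | H | inj₁ (f , p) = inj₁ ((λ { zero e → H≢I (trans (sym eq) e) ; (suc i) → f i }) , cons refl (cons refl (cons refl p)))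
  where
  H≢I : ¬ (_≡_ {A = Γ} H I)
  H≢I ()

input : ∀ {n} → (Fin n → Fin n → Bool) → (Fin n → Bool) → List Γ
input A U = map bit (rowBits A) ++ H ∷ map bit (tabulate U)

served : ∀ {n} → (Fin n → Fin n → Bool) → (Fin n → Bool) → Fin n → Γ
served A U = updates 0 A (bit ∘ U)

scanMatrix : ∀ {n} (A : Fin n → Fin n → Bool) x →
  ∃[ d ] Sweeps (n * suc n) nextBit (map bit (rowBits A) ++ H ∷ columns (Scan (unit 0) unscanned x))
                nextBit (H ∷ columns (Scan d unscanned (updates 0 A x)))
-- A row without bits would never trigger a reset, so the empty matrix is treated apart.
scanMatrix {zero}  A x = unit 0 , []
scanMatrix {suc n} A x = scanRows 0 A x

-- In order: the mark, the bits of A, the separator, the bits of U, removal of the mark; then one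
-- initialising reset and `suc n` sweeps for each row.
sweepsNeeded : ∀ {n} → (Fin n → Fin n → Bool) → (Fin n → Bool) → ℕ
sweepsNeeded {n} A U = suc (length (rowBits A) + suc (length (tabulate U) + 1)) + (1 + n * suc n)

program-correct : ∀ {n} (A : Fin n → Fin n → Bool) (U : Fin n → Bool) →
  ∃[ b ] Decides (sweepsNeeded A U) (input A U) b × (b ≡ true → ∀ i → served A U i ≢ I) × ((∀ i → served A U i ≢ I) → b ≡ true)
program-correct {n} A U = verdict (checking d unscanned (served A U))
  where
  x₀ : List Column
  x₀ = Scan (unit 0) unscanned (bit ∘ U)
  prepare : Sweep (reset I O) (map bit (rowBits A) ++ H ∷ columns (map fresh (tabulate U))) nextBit
                  (map bit (rowBits A) ++ H ∷ columns x₀)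
  prepare rewrite map-tabulate U fresh =
    resetting I O (λ _ → O) unscanned (bit ∘ U) (bits≢H (rowBits A))
    ▹ cong (λ cs → map bit (rowBits A) ++ H ∷ columns cs) (Scan-cong unscanned (bit ∘ U) shift-I)
  scanned : ∃[ d ] Sweeps (n * suc n) nextBit (map bit (rowBits A) ++ H ∷ columns x₀) nextBit (H ∷ columns (Scan d unscanned (served A U)))
  scanned = scanMatrix A (bit ∘ U)
  d : Fin n → Γ
  d = proj₁ scanned
  sweeps : Sweeps (sweepsNeeded A U) mark (input A U) nextBit (H ∷ columns (Scan d unscanned (served A U)))
  sweeps = rotating (rowBits A) (tabulate U) ++ˢ (prepare ∷ proj₂ scanned)
  verdict : _ → _
  verdict (inj₁ (ok , p)) = true , record { sweeps = sweeps ; lastPass = cons refl p ; halts = refl } , (λ _ → ok) , (λ _ → refl)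
  verdict (inj₂ ((i , bad) , p)) = false , record { sweeps = sweeps ; lastPass = cons refl p ; halts = refl } , (λ ()) , (λ ok → ⊥-elim (ok i bad))

-- Correctness of the program

Hit : Γ → Γ → Set
Hit h x = h ≡ I × x ≢ O

bump : Γ → Γ
bump O = I
bump _ = H

-- A column either raises every count or leaves every count alone; the counting lemmas below need
-- only this distinction per column.
tally-view : ∀ h x → (Hit h x × (∀ c → tally c h x ≡ bump c)) ⊎ (¬ Hit h x × (∀ c → tally c h x ≡ c))
tally-view O x = inj₂ ((λ { (() , _) }) , λ { O → refl ; I → refl ; H → refl })
tally-view H x = inj₂ ((λ { (() , _) }) , λ { O → refl ; I → refl ; H → refl })
tally-view I O = inj₂ ((λ { (_ , ne) → ne refl }) , λ _ → refl)
tally-view I I = inj₁ ((refl , λ ()) , λ { O → refl ; I → refl ; H → refl })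
tally-view I H = inj₁ ((refl , λ ()) , λ { O → refl ; I → refl ; H → refl })

hits-none : ∀ {n} c (d h x : Fin n → Γ) → (∀ j → ¬ Hit (h j) (x j)) → hits c (Scan d h x) ≡ c
hits-none {zero}  c d h x none = refl
hits-none {suc n} c d h x none with tally-view (h 0F) (x 0F)
... | inj₁ (p , _) = ⊥-elim (none 0F p)
... | inj₂ (_ , e) rewrite e c = hits-none c (d ∘ suc) (h ∘ suc) (x ∘ suc) (none ∘ suc)

hits-H : ∀ {n} (d h x : Fin n → Γ) → hits H (Scan d h x) ≡ H
hits-H {zero}  d h x = refl
hits-H {suc n} d h x with tally-view (h 0F) (x 0F)
... | inj₁ (_ , e) rewrite e H = hits-H (d ∘ suc) (h ∘ suc) (x ∘ suc)
... | inj₂ (_ , e) rewrite e H = hits-H (d ∘ suc) (h ∘ suc) (x ∘ suc)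

-- Another hit would raise the count to `H`, where it stays by `hits-H`.
hits-I : ∀ {n} (d h x : Fin n → Γ) → hits I (Scan d h x) ≡ I → ∀ j → ¬ Hit (h j) (x j)
hits-I {suc n} d h x eq j with tally-view (h 0F) (x 0F)
hits-I {suc n} d h x eq j | inj₁ (_ , e) rewrite e I with trans (sym eq) (hits-H (d ∘ suc) (h ∘ suc) (x ∘ suc))
... | ()
hits-I {suc n} d h x eq zero    | inj₂ (q , e) = q
hits-I {suc n} d h x eq (suc j) | inj₂ (q , e) rewrite e I = hits-I (d ∘ suc) (h ∘ suc) (x ∘ suc) eq j

hits-unique⁻ : ∀ {n} (d h x : Fin n → Γ) → hits O (Scan d h x) ≡ I →
               ∀ i j → Hit (h i) (x i) → Hit (h j) (x j) → j ≡ i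
hits-unique⁻ {suc n} d h x eq i j p q with tally-view (h 0F) (x 0F)
hits-unique⁻ {suc n} d h x eq zero    zero    p q | inj₁ (_ , e) = refl
hits-unique⁻ {suc n} d h x eq (suc i) j       p q | inj₁ (_ , e) rewrite e O = ⊥-elim (hits-I (d ∘ suc) (h ∘ suc) (x ∘ suc) eq i p)
hits-unique⁻ {suc n} d h x eq zero    (suc j) p q | inj₁ (_ , e) rewrite e O = ⊥-elim (hits-I (d ∘ suc) (h ∘ suc) (x ∘ suc) eq j q)
hits-unique⁻ {suc n} d h x eq zero    j       p q | inj₂ (r , e) = ⊥-elim (r p)
hits-unique⁻ {suc n} d h x eq (suc i) zero    p q | inj₂ (r , e) = ⊥-elim (r q)
hits-unique⁻ {suc n} d h x eq (suc i) (suc j) p q | inj₂ (r , e) rewrite e O =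
  cong suc (hits-unique⁻ (d ∘ suc) (h ∘ suc) (x ∘ suc) eq i j p q)

hits-unique⁺ : ∀ {n} (d h x : Fin n → Γ) i → Hit (h i) (x i) → (∀ j → Hit (h j) (x j) → j ≡ i) →
               hits O (Scan d h x) ≡ I
hits-unique⁺ {suc n} d h x zero p unique with tally-view (h 0F) (x 0F)
... | inj₂ (q , _) = ⊥-elim (q p)
... | inj₁ (_ , e) rewrite e O = hits-none I (d ∘ suc) (h ∘ suc) (x ∘ suc) (λ j q → 0≢suc (unique (suc j) q))
  where
  0≢suc : ∀ {n} {j : Fin n} → suc j ≢ zero
  0≢suc ()
hits-unique⁺ {suc n} d h x (suc i) p unique with tally-view (h 0F) (x 0F)
... | inj₂ (_ , e) rewrite e O = hits-unique⁺ (d ∘ suc) (h ∘ suc) (x ∘ suc) i p (λ j q → suc-injective (unique (suc j) q))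
... | inj₁ (q , _) with unique 0F q
...   | ()

single-I : ∀ c → single c ≡ I → c ≡ I
single-I I _ = refl
single-I O ()
single-I H ()

serve-H⁻ : ∀ u h x → serve u h x ≡ H → x ≡ H ⊎ (u ≡ I × h ≡ I × x ≡ I)
serve-H⁻ u h H eq = inj₁ refl
serve-H⁻ I I I eq = inj₂ (refl , refl , refl)
serve-H⁻ O h O ()
serve-H⁻ O h I ()
serve-H⁻ H h O ()
serve-H⁻ H h I ()
serve-H⁻ I O O ()
serve-H⁻ I O I ()
serve-H⁻ I I O ()
serve-H⁻ I H O ()
serve-H⁻ I H I ()

serve-H : ∀ u h → serve u h H ≡ H
serve-H O h = refl
serve-H H h = refl
serve-H I O = refl
serve-H I I = refl
serve-H I H = refl

serve-O : ∀ u h → serve u h O ≡ O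
serve-O O h = refl
serve-O H h = refl
serve-O I O = refl
serve-O I I = refl
serve-O I H = refl

serve-≢O : ∀ u h x → x ≢ O → serve u h x ≢ O
serve-≢O u h O ne = ⊥-elim (ne refl)
serve-≢O u h H ne rewrite serve-H u h = ne
serve-≢O O h I ne = ne
serve-≢O H h I ne = ne
serve-≢O I O I ne = ne
serve-≢O I I I ne = λ ()
serve-≢O I H I ne = ne

serve-I : ∀ x → x ≢ O → serve I I x ≡ H
serve-I O ne = ⊥-elim (ne refl)
serve-I I ne = refl
serve-I H ne = refl

unit⁺ : ∀ {n} (i : Fin n) → unit (toℕ i) i ≡ I
unit⁺ zero    = refl
unit⁺ (suc i) = unit⁺ i

unit⁻ : ∀ {n} k (i : Fin n) → unit k i ≡ I → k ≡ toℕ i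
unit⁻ zero    zero    eq = refl
unit⁻ (suc k) (suc i) eq = cong suc (unit⁻ k i eq)

or-I⁻ : ∀ b d → bit b or d ≡ I → b ≡ true ⊎ d ≡ I
or-I⁻ true  d eq = inj₁ refl
or-I⁻ false I eq = inj₂ refl

or-I : ∀ b → bit b or I ≡ I
or-I false = refl
or-I true  = refl

-- The invariant over the rows

module _ {n} (A : Adjacency n) (U : Fin n → Bool) where

  hits-row : Fin n → Fin n → Γ
  hits-row w = hit (A w) (unit (toℕ w))

  near⇒hit : ∀ {w i} → Near A w i → hits-row w i ≡ I
  near⇒hit {w} (inj₁ refl) rewrite unit⁺ w = or-I (A w w)
  near⇒hit     (inj₂ e)    rewrite e = refl

  hit⇒near : ∀ {w i} → hits-row w i ≡ I → Near A w i
  hit⇒near {w} {i} eq with or-I⁻ (A w i) _ eq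
  ... | inj₁ e = inj₂ e
  ... | inj₂ e = inj₁ (toℕ-injective (unit⁻ (toℕ w) i e))

  Private : Fin n → Fin n → Set
  Private w i = Near A w i × (∀ j → U j ≡ true → Near A w j → j ≡ i)

  -- State after `k` rows. The first two fields say that `x` still determines `U`, so hits can be
  -- counted from `x` even though serving changes symbols; the other two tie the symbol `H` to
  -- private vertices.
  record Invariant (k : ℕ) (x : Fin n → Γ) : Set where
    field
      outside  : ∀ {i} → U i ≡ false → x i ≡ O
      inside   : ∀ {i} → U i ≡ true → x i ≢ O
      sound    : ∀ {i} → x i ≡ H → ∃[ w ] Private w i
      complete : ∀ {w i} → toℕ w < k → U i ≡ true → Private w i → x i ≡ H

    ≢O⇒U : ∀ {i} → x i ≢ O → U i ≡ true
    ≢O⇒U {i} ne with U i in eq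
    ... | true  = refl
    ... | false = ⊥-elim (ne (outside eq))

  initially : Invariant 0 (bit ∘ U)
  initially = record
    { outside  = λ e → cong bit e
    ; inside   = λ {i} e eq → I≢O (trans (sym (cong bit e)) eq)
    ; sound    = λ {i} eq → ⊥-elim (bit≢H (U i) eq)
    ; complete = λ () }
    where
    I≢O : ¬ (_≡_ {A = Γ} I O)
    I≢O ()

  -- The hits of row `w` are the elements of N[w] in `U`, so a count of one means that `w` is
  -- private to the vertex being served. Marks from earlier rows persist because `serve` fixes `H`.
  preserved : ∀ w {x} → Invariant (toℕ w) x → Invariant (suc (toℕ w)) (update (toℕ w) (A w) x)
  preserved w {x} inv = record
    { outside  = λ {i} e → trans (cong (serve u (hits-row w i)) (outside e)) (serve-O u _)
    ; inside   = λ {i} e → serve-≢O u _ (x i) (inside e)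
    ; sound    = sound′
    ; complete = complete′ }
    where
    open Invariant inv
    u : Γ
    u = single (hits O (Scan (unit (toℕ w)) (hits-row w) x))
    sound′ : ∀ {i} → serve u (hits-row w i) (x i) ≡ H → ∃[ w ] Private w i
    sound′ {i} eq with serve-H⁻ u _ (x i) eq
    ... | inj₁ e = sound e
    ... | inj₂ (u≡I , h≡I , x≡I) = w , hit⇒near h≡I , λ j j∈U near →
      hits-unique⁻ (unit (toℕ w)) _ x (single-I _ u≡I) i j (h≡I , λ e → I≢O (trans (sym x≡I) e)) (near⇒hit near , inside j∈U)
      where
      I≢O : ¬ (_≡_ {A = Γ} I O)
      I≢O ()
    complete′ : ∀ {v i} → toℕ v < suc (toℕ w) → U i ≡ true → Private v i → serve u (hits-row w i) (x i) ≡ H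
    complete′ {v} {i} (s≤s v≤w) i∈U pr with m≤n⇒m<n∨m≡n v≤w
    ... | inj₁ v<w = trans (cong (serve u (hits-row w i)) (complete v<w i∈U pr)) (serve-H u _)
    ... | inj₂ v≡w with toℕ-injective v≡w
    ...   | refl = trans (cong₂ (λ u h → serve u h (x i)) u≡I (near⇒hit (proj₁ pr))) (serve-I (x i) (inside i∈U))
      where
      u≡I : u ≡ I
      u≡I = cong single (hits-unique⁺ (unit (toℕ w)) (hits-row w) x i (near⇒hit (proj₁ pr) , inside i∈U)
              (λ j (h , ne) → proj₂ pr j (≢O⇒U ne) (hit⇒near h)))

  -- `updates` peels rows off the front; `f` recovers the original index of each remaining row,
  -- which is `k` plus its present position.
  preserved* : ∀ {m} k (f : Fin m → Fin n) → (∀ i → toℕ (f i) ≡ k + toℕ i) → ∀ {x} →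
               Invariant k x → Invariant (k + m) (updates k (A ∘ f) x)
  preserved* {zero}  k f eq inv = subst (λ k → Invariant k _) (sym (+-identityʳ k)) inv
  preserved* {suc m} k f eq {x} inv = subst (λ k′ → Invariant k′ (updates k (A ∘ f) x)) (sym (+-suc k m))
    (preserved* (suc k) (f ∘ suc) (λ i → trans (eq (suc i)) (+-suc k (toℕ i))) step₁)
    where
    first : toℕ (f zero) ≡ k
    first = trans (eq zero) (+-identityʳ k)
    step₁ : Invariant (suc k) (update k (A (f zero)) x)
    step₁ = subst (λ k → Invariant (suc k) (update k (A (f zero)) x)) first
              (preserved (f zero) (subst (λ k → Invariant k x) (sym first) inv))

  finally : Invariant n (served A U)
  finally = preserved* 0 id (λ _ → refl) initially

  all-served⇒private : (∀ i → served A U i ≢ I) → ∀ i → U i ≡ true → ∃[ w ] Private w i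
  all-served⇒private ok i i∈U with served A U i in eq
  ... | O = ⊥-elim (Invariant.inside finally i∈U eq)
  ... | I = ⊥-elim (ok i eq)
  ... | H = Invariant.sound finally eq

  private⇒all-served : (∀ i → U i ≡ true → ∃[ w ] Private w i) → ∀ i → served A U i ≢ I
  private⇒all-served pr i eq = I≢H (trans (sym eq) (Invariant.complete finally (toℕ<n w) i∈U private-w))
    where
    I≢H : ¬ (_≡_ {A = Γ} I H)
    I≢H ()
    I≢O : ¬ (_≡_ {A = Γ} I O)
    I≢O ()
    i∈U : U i ≡ true
    i∈U = Invariant.≢O⇒U finally (λ e → I≢O (trans (sym eq) e))
    w : Fin n
    w = proj₁ (pr i i∈U)
    private-w : Private w i
    private-w = proj₂ (pr i i∈U)

-- Input encoding and time bound

bitSym-bit : ∀ b → bitSym b ≡ suc (bit b)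
bitSym-bit false = refl
bitSym-bit true  = refl

map-bitSym : ∀ bs → map bitSym bs ≡ map suc (map bit bs)
map-bitSym bs = trans (map-cong bitSym-bit bs) (map-∘ bs)

toList-lookup : ∀ {n} (U : Vec.Vec Bool n) → Vec.toList U ≡ tabulate (Vec.lookup U)
toList-lookup Vec.[]      = refl
toList-lookup (b Vec.∷ U) = cong (b ∷_) (toList-lookup U)

map-rows : ∀ {m n} (A : Adjacency n) (f : Fin m → Fin n) →
           concatMap (λ u → map (λ v → bitSym (A u v)) (allFin n)) (tabulate f) ≡ map bitSym (rowBits (A ∘ f))
map-rows {zero}  A f = refl
map-rows {suc m} {n} A f = trans
  (cong₂ _++_ (trans (map-tabulate id (λ v → bitSym (A (f zero) v))) (sym (map-tabulate (A (f zero)) bitSym))) (map-rows A (f ∘ suc)))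
  (sym (map-++ bitSym (tabulate (A (f zero))) (rowBits (A ∘ f ∘ suc))))

encode-input : ∀ n (A : Adjacency n) (U : Subset n) → encode n A U ≡ map suc (input A (Vec.lookup U))
encode-input n A U = trans
  (cong₂ (λ as us → as ++ sepSym ∷ us)
    (trans (map-rows A id) (map-bitSym (rowBits A)))
    (trans (cong (map bitSym) (toList-lookup U)) (map-bitSym (tabulate (Vec.lookup U)))))
  (sym (map-++ suc (map bit (rowBits A)) _))

length-rowBits : ∀ {m n} (A : Fin m → Fin n → Bool) → length (rowBits A) ≡ m * n
length-rowBits {zero}  A = refl
length-rowBits {suc m} A = trans (length-++ (tabulate (A zero)))
  (cong₂ _+_ (length-tabulate (A zero)) (length-rowBits (A ∘ suc)))

length-input : ∀ {n} (A : Adjacency n) U → length (input A U) ≡ n * n + suc n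
length-input A U = trans (length-++ (map bit (rowBits A)))
  (cong₂ (λ a u → a + suc u) (trans (length-map bit (rowBits A)) (length-rowBits A))
                             (trans (length-map bit (tabulate U)) (length-tabulate U)))

sweeps-bound : ∀ {n} (A : Adjacency n) U → suc (sweepsNeeded A U) ≤ 4 * suc (length (input A U))
sweeps-bound {n} A U rewrite length-rowBits A | length-tabulate U | length-input A U = begin
  suc (suc (n * n + suc (n + 1)) + (1 + n * suc n))
    ≡⟨ solve 1 (λ n → con 1 :+ ((con 1 :+ (n :* n :+ (con 1 :+ (n :+ con 1)))) :+ (con 1 :+ n :* (con 1 :+ n)))
                     := con 2 :* (n :* n) :+ con 2 :* n :+ con 5) refl n ⟩
  2 * (n * n) + 2 * n + 5
    -- The added term is exactly the difference to `4 * suc (n * n + suc n)`.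
    ≤⟨ m≤m+n _ (2 * (n * n) + 2 * n + 3) ⟩
  2 * (n * n) + 2 * n + 5 + (2 * (n * n) + 2 * n + 3)
    ≡⟨ solve 1 (λ n → con 2 :* (n :* n) :+ con 2 :* n :+ con 5 :+ (con 2 :* (n :* n) :+ con 2 :* n :+ con 3)
                     := con 4 :* (con 1 :+ (n :* n :+ (con 1 :+ n)))) refl n ⟩
  4 * suc (n * n + suc n) ∎
  where
  open ≤-Reasoning
  open +-*-Solver

-- With L for `suc l`, the product is at most 4L (2 (L + 12L) + 8L) = 4L · 34L, which is where 136
-- comes from.
time-bound : ∀ l M → M ≤ 4 * suc l → M * (2 * (l + 3 * M) + 8) ≤ 136 * suc l ^ 2
time-bound l M M≤ = begin
  M * (2 * (l + 3 * M) + 8)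
    ≤⟨ *-mono-≤ M≤ (+-mono-≤ (*-monoʳ-≤ 2 (+-mono-≤ (n≤1+n l) (*-monoʳ-≤ 3 M≤))) (*-monoʳ-≤ 8 (s≤s (z≤n {l})))) ⟩
  4 * suc l * (2 * (suc l + 3 * (4 * suc l)) + 8 * suc l)
    ≡⟨ solve 1 (λ L → con 4 :* L :* (con 2 :* (L :+ con 3 :* (con 4 :* L)) :+ con 8 :* L) := con 136 :* (L :^ 2)) refl (suc l) ⟩
  136 * suc l ^ 2 ∎
  where
  open ≤-Reasoning
  open +-*-Solver

decides : ∀ (n : ℕ) (A : Adjacency n) (U : Subset n) → IsSimple A → IsSplit A →
  ∃[ b ] ∃[ t ]
    ( t ≤ 136 * suc (length (encode n A U)) ^ 2
    × outcome machine (encode n A U) t ≡ just b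
    × (b ≡ true → ExtensionDS A U)
    × (ExtensionDS A U → b ≡ true))
decides n A U simple (K , clique , independent) =
  let (b , d , accepts , accepts′) = program-correct A (Vec.lookup U)
      (t , t≤ , out) = decide d
  in b , t ,
     subst (λ l → t ≤ 136 * suc l ^ 2) (sym |x|) (≤-trans t≤ (time-bound _ _ (sweeps-bound A (Vec.lookup U)))) ,
     subst (λ x → outcome machine x t ≡ just b) (sym (encode-input n A U)) out ,
     (λ e → irredundant⇒extensible A simple K clique independent (irr (all-served⇒private A _ (accepts e)))) ,
     (λ ext → accepts′ (private⇒all-served A _ (pr (extensible⇒irredundant A simple ext))))
  where
  |x| : length (encode n A U) ≡ length (input A (Vec.lookup U))
  |x| = trans (cong length (encode-input n A U)) (length-map suc (input A (Vec.lookup U)))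
  irr : (∀ i → Vec.lookup U i ≡ true → ∃[ w ] Private A (Vec.lookup U) w i) → Irredundant A U
  irr p u u∈U = let (w , near , unique) = p u ([]=⇒lookup u∈U) in w , near , λ j j∈U → unique j ([]=⇒lookup j∈U)
  pr : Irredundant A U → ∀ i → Vec.lookup U i ≡ true → ∃[ w ] Private A (Vec.lookup U) w i
  pr q i i∈U = let (w , near , unique) = q i (lookup⇒[]= i U i∈U) in w , near , λ j j∈U → unique j (lookup⇒[]= j U j∈U)

theorem22 : Σ TM λ M → ∃[ c ] ∃[ k ]
    (∀ (n : ℕ) (A : Adjacency n) (U : Subset n) → IsSimple A → IsSplit A →
    ∃[ b ] ∃[ t ]
    ( t ≤ c * suc (length (encode n A U)) ^ k
    × outcome M (encode n A U) t ≡ just b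
    × (b ≡ true → ExtensionDS A U)
    × (ExtensionDS A U → b ≡ true)))
theorem22 = machine , 136 , 2 , decides
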